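{- Let $\mathbf{a}$ be a weak $m$-part composition of $n$ and let $t=(k,l)$ be a lattice point (with $0\le l\le m$) dominated by all cyclic shifts of $\mathbf{a}$. Then for every integer $c$, $$|\mathscr{G}_t(\mathbf{a})\cap\mathscr{C}_{c}| = m\binom{k+1}{c}\binom{l-1}{c-1}-n\binom{k}{c-1}\binom{l}{c}.$$
   Context: Lattice paths use unit steps $(0,1)$ (up) and $(1,0)$ (right). $\mathbf{a}=(a_0,\ldots,a_{m-1})$ is a tuple of nonnegative integers summing to $n$; indices read mod $m$. Let $f_{\mathbf{a}}(y)=a_r(y-r)+\sum_{j=0}^{r-1}a_j$ for $y\in[r,r+1]$, $0\le r<m$. A lattice point $(x,y)$ with $0\le y\le m$ is dominated by $\mathbf{a}$ if $x\ge f_{\mathbf{a}}(y)$; a path is dominated if all its lattice points are. Cyclic shifts: $\mathbf{a}^{j}=(a_{ -j},\ldots,a_{ -j+m-1})$. An LPBP is a pair $(P,(\mathbf{a},j))$ with $P$ a lattice path from the origin and $0\le j<m$; it is good if $P$ is dominated by $\mathbf{a}^j$. $\mathscr{G}_t(\mathbf{a})$ is the set of good LPBPs whose path ends at $t$. A right-up corner of a path is a point where a right step is immediately followed by an up step; in addition, an initial up step of the path counts as one (virtual) right-up corner. $\mathscr{C}_{c}$ is the set of LPBPs whose path has exactly $c$ right-up corners (real or virtual). -}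

module Defs where

open import Data.Nat using (ℕ; zero; suc; _+_; _∸_; _≤_; _%_; NonZero)
open import Data.Nat.DivMod using (m%n<n)
open import Data.Nat.Combinatorics using (_C_)
open import Data.Integer as ℤ using (ℤ; +_; -[1+_])
open import Data.Fin using (Fin; fromℕ<; toℕ) renaming (zero to fzero; suc to fsuc)
open import Data.List using (List; []; _∷_)
open import Data.List.Relation.Unary.All using (All)
open import Data.Product using (Σ; _×_; _,_)
open import Relation.Binary.PropositionalEquality using (_≡_)

sumTo : (ℕ → ℕ) → ℕ → ℕ
sumTo f zero    = 0
sumTo f (suc r) = sumTo f r + f r

sumFin : ∀ {m} → (Fin m → ℕ) → ℕ
sumFin {zero}  f = 0
sumFin {suc m} f = f fzero + sumFin {m} (λ i → f (fsuc i))

IsComposition : (m n : ℕ) → (Fin m → ℕ) → Set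
IsComposition m n a = sumFin a ≡ n

idx : (m : ℕ) .{{_ : NonZero m}} → (Fin m → ℕ) → ℕ → ℕ
idx m a i = a (fromℕ< (m%n<n i m))

-- cyclic shift a^j : (a^j)_i = a_{i-j mod m}, as a function ℕ → ℕ (indices mod m)
shift : (m : ℕ) .{{_ : NonZero m}} → (Fin m → ℕ) → Fin m → ℕ → ℕ
shift m a j i = idx m a (i + (m ∸ toℕ j))

Point : Set
Point = ℕ × ℕ

DominatedPt : (m : ℕ) → (ℕ → ℕ) → Point → Set
DominatedPt m b (x , y) = y ≤ m × sumTo b y ≤ x

data Step : Set where
  up right : Step

Path : Set
Path = List Step

move : Point → Step → Point
move (x , y) up    = (x , suc y)
move (x , y) right = (suc x , y)

pointsFrom : Point → Path → List Point
pointsFrom p []      = p ∷ []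
pointsFrom p (s ∷ P) = p ∷ pointsFrom (move p s) P

points : Path → List Point
points = pointsFrom (0 , 0)

endFrom : Point → Path → Point
endFrom p []      = p
endFrom p (s ∷ P) = endFrom (move p s) P

endpoint : Path → Point
endpoint = endFrom (0 , 0)

Dominated : (m : ℕ) → (ℕ → ℕ) → Path → Set
Dominated m b P = All (DominatedPt m b) (points P)

ruCorners : Path → ℕ
ruCorners []                  = 0
ruCorners (right ∷ up ∷ P)    = suc (ruCorners (up ∷ P))
ruCorners (_ ∷ P)             = ruCorners P

-- real corners plus one virtual corner if the path starts with an up step
corners : Path → ℕ
corners (up ∷ P) = suc (ruCorners (up ∷ P))
corners P        = ruCorners P

-- G_t(a) ∩ C_c : good LPBPs (P , (a , j)) with P ending at t and having exactly c corners
GoodWithCorners : (m : ℕ) .{{_ : NonZero m}} → (Fin m → ℕ) → Point → ℤ → Set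
GoodWithCorners m a t c =
  Σ (Fin m) λ j → Σ Path λ P →
    endpoint P ≡ t × Dominated m (shift m a j) P × (+ corners P) ≡ c

-- Integer binomial coefficient.  Convention: C(x,y) = x choose y for 0 ≤ x, 0 ≤ y
-- (which is 0 when y > x); C(-1,-1) = 1; all other values 0.
-- (C(-1,-1) = 1 is needed for the case l = 0, c = 0.)
binomℤ : ℤ → ℤ → ℤ
binomℤ (+ x) (+ y)           = + (x C y)
binomℤ -[1+ zero ] -[1+ zero ] = + 1
binomℤ _ _                   = + 0

{-# OPTIONS --safe #-}

-- Let p be the longest dominated initial segment of the path P of a bad pair
-- (P , (a , j)), so that P = p ++ up ∷ q and the displayed up step crosses a unit of
-- the horizontal boundary run a_r.  Send the pair to Q = q ++ right ∷ p together with
-- that unit.  This is a bijection onto all pairs of a path Q to (k + 1 , l − 1) and one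
-- of the n units: hang the boundary backwards from the end of Q, the marked unit
-- starting there; since (k , l) is dominated by every shift, Q starts strictly to the
-- left of it, and the last right step reaching it cuts Q into q and p.  Up to rotation,
-- right ∷ P and Q ++ up ∷ [] are the same cyclic word, so the bad pairs with c corners
-- number n times the paths Q for which Q ++ up ∷ [] has c corners.
module Submission where

open import Defs
open import Data.Nat using (ℕ; suc; _≤_; NonZero)
open import Data.Integer using (ℤ; +_; _*_; _-_)
open import Data.Fin using (Fin)
open import Data.Product using (Σ; _×_; _,_)
open import Function.Bundles using (_↔_)
open import Relation.Binary.PropositionalEquality using (_≡_)

open import Axiom.UniquenessOfIdentityProofs.WithK using (uip)
open import Data.Bool using (true; false; T; if_then_else_)
open import Data.Empty using (⊥-elim)
open import Data.Fin using (fromℕ<; toℕ; punchIn; punchOut) renaming (zero to fzero; suc to fsuc)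
open import Data.Fin.Properties
  using (toℕ-injective; toℕ-fromℕ<; toℕ<n;
    punchOut-injective; punchOut-cong; punchInᵢ≢i; punchOut-punchIn; +↔⊎; *↔×)
open import Data.Integer using (-[1+_]; _⊖_)
import Data.Integer.Properties as ℤₚ
open import Data.List using (List; []; _∷_; _++_)
open import Data.List.Properties using (++-assoc; ++-identityʳ; ∷-injective)
open import Data.List.Relation.Unary.All as All using (All; []; _∷_)
open import Data.Nat as ℕ using (zero; s≤s; _+_; _∸_; _<_; _%_; pred)
open import Data.Nat.Combinatorics using (_C_; nCk+nC[k+1]≡[n+1]C[k+1])
open import Data.Nat.DivMod
  using (m%n%n≡m%n; [m+kn]%n≡m%n; [m+n]%n≡m%n; %-distribˡ-+; m<n⇒m%n≡m; m%n<n)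
import Data.Nat.Properties as ℕₚ
open import Data.Nat.Solver using (module +-*-Solver)
open import Data.Product using (∃; proj₁; proj₂)
open import Data.Product.Function.NonDependent.Propositional using (_×-↔_)
open import Data.Product.Properties using (,-injective)
open import Data.Sum using (_⊎_; inj₁; inj₂)
open import Data.Sum.Function.Propositional using (_⊎-↔_)
open import Data.Sum.Properties using (inj₂-injective)
open import Data.Unit using (⊤; tt)
open import Function using (_∘_; id)
open import Function.Bundles using (mk↔ₛ′; module Inverse)
open import Function.Properties.Inverse using (↔-refl; ↔-sym; ↔-trans)
open import Relation.Binary.PropositionalEquality
  using (_≢_; refl; sym; trans; cong; cong₂; subst; subst₂; module ≡-Reasoning)
open import Relation.Nullary as Nullary using (¬_; Dec; yes; no)
open import Relation.Unary using (Decidable)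

-- Counting finite types through bijections

injective∧surjective⇒↔ : {A B : Set} (f : A → B) → (∀ {x y} → f x ≡ f y → x ≡ y) →
  (∀ y → ∃ λ x → f x ≡ y) → A ↔ B
injective∧surjective⇒↔ f inj surj =
  mk↔ₛ′ f (proj₁ ∘ surj) (proj₂ ∘ surj) (λ x → inj (proj₂ (surj (f x))))

Σ-≡ : {A : Set} {P : A → Set} → (∀ {x} → Nullary.Irrelevant (P x)) →
  {p q : Σ A P} → proj₁ p ≡ proj₁ q → p ≡ q
Σ-≡ irr {x , p} {_ , q} refl = cong (x ,_) (irr p q)

×-irrelevant : {A B : Set} → Nullary.Irrelevant A → Nullary.Irrelevant B → Nullary.Irrelevant (A × B)
×-irrelevant irrA irrB (x , y) (x′ , y′) = cong₂ _,_ (irrA x x′) (irrB y y′)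

empty↔Fin0 : {A : Set} → ¬ A → A ↔ Fin 0
empty↔Fin0 ¬a = mk↔ₛ′ (⊥-elim ∘ ¬a) (λ ()) (λ ()) (⊥-elim ∘ ¬a)

-- `punchOut` closes the gap left by the image of `inj₁ tt`; injectivity of `e` keeps every `inj₂ x`
-- away from it.
⊤⊎-cancel : ∀ {A : Set} {n} → (⊤ ⊎ A) ↔ Fin (suc n) → A ↔ Fin n
⊤⊎-cancel {A} {n} e = injective∧surjective⇒↔ f f-injective f-surjective
  where
  open Inverse e using (to; from; strictlyInverseˡ; strictlyInverseʳ)
  to-injective : ∀ {x y} → to x ≡ to y → x ≡ y
  to-injective {x} {y} eq =
    trans (sym (strictlyInverseʳ x)) (trans (cong from eq) (strictlyInverseʳ y))
  apart : ∀ x → to (inj₁ tt) ≢ to (inj₂ x)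
  apart x eq with () ← to-injective eq
  f : A → Fin n
  f x = punchOut (apart x)
  f-injective : ∀ {x y} → f x ≡ f y → x ≡ y
  f-injective {x} {y} eq = inj₂-injective (to-injective (punchOut-injective (apart x) (apart y) eq))
  f-surjective : ∀ y → ∃ λ x → f x ≡ y
  f-surjective y with from (punchIn (to (inj₁ tt)) y) in eq
  ... | inj₁ tt = ⊥-elim (punchInᵢ≢i (to (inj₁ tt)) y
          (sym (trans (cong to (sym eq)) (strictlyInverseˡ _))))
  ... | inj₂ x = x , trans (punchOut-cong (to (inj₁ tt)) (trans (cong to (sym eq)) (strictlyInverseˡ _)))
                           (punchOut-punchIn (to (inj₁ tt)))

-- Subtraction of cardinalities, cancelling the elements of `B` one at a time. It serves to count
-- the good pairs without enumerating them.
⊎-complement : ∀ {A B : Set} {m n} → (A ⊎ B) ↔ Fin m → B ↔ Fin n →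
  ∃ λ p → (A ↔ Fin p) × p + n ≡ m
⊎-complement {A} e f = go _ _ (↔-trans (↔-refl ⊎-↔ ↔-sym f) e)
  where
  drop : (A ⊎ Fin 0) ↔ A
  drop = mk↔ₛ′ (λ { (inj₁ x) → x ; (inj₂ ()) }) inj₁ (λ _ → refl) (λ { (inj₁ _) → refl ; (inj₂ ()) })
  go : ∀ m n → (A ⊎ Fin n) ↔ Fin m → ∃ λ p → (A ↔ Fin p) × p + n ≡ m
  go m zero e = m , ↔-trans (↔-sym drop) e , ℕₚ.+-identityʳ m
  go zero (suc n) e with () ← Inverse.to e (inj₂ fzero)
  go (suc m) (suc n) e with go m n (⊤⊎-cancel (↔-trans pull e))
    where
    pull : (⊤ ⊎ (A ⊎ Fin n)) ↔ (A ⊎ Fin (suc n))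
    pull = mk↔ₛ′
      (λ { (inj₁ _) → inj₂ fzero ; (inj₂ (inj₁ x)) → inj₁ x ; (inj₂ (inj₂ i)) → inj₂ (fsuc i) })
      (λ { (inj₁ x) → inj₂ (inj₁ x) ; (inj₂ fzero) → inj₁ tt ; (inj₂ (fsuc i)) → inj₂ (inj₂ i) })
      (λ { (inj₁ x) → refl ; (inj₂ fzero) → refl ; (inj₂ (fsuc i)) → refl })
      (λ { (inj₁ _) → refl ; (inj₂ (inj₁ x)) → refl ; (inj₂ (inj₂ i)) → refl })
  ... | p , e′ , eq = p , e′ , trans (ℕₚ.+-suc p n) (cong suc eq)

ΣFin↔Fin-sumFin : ∀ {m} (a : Fin m → ℕ) → Σ (Fin m) (Fin ∘ a) ↔ Fin (sumFin a)
ΣFin↔Fin-sumFin {zero} a = empty↔Fin0 λ ()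
ΣFin↔Fin-sumFin {suc m} a = ↔-trans peel
  (↔-trans (↔-refl ⊎-↔ ΣFin↔Fin-sumFin (a ∘ fsuc)) (↔-sym +↔⊎))
  where
  peel : Σ (Fin (suc m)) (Fin ∘ a) ↔ (Fin (a fzero) ⊎ Σ (Fin m) (Fin ∘ a ∘ fsuc))
  peel = mk↔ₛ′
    (λ { (fzero , o) → inj₁ o ; (fsuc r , o) → inj₂ (r , o) })
    (λ { (inj₁ o) → fzero , o ; (inj₂ (r , o)) → fsuc r , o })
    (λ { (inj₁ o) → refl ; (inj₂ _) → refl })
    (λ { (fzero , o) → refl ; (fsuc r , o) → refl })

-- Cutting a list at its shortest prefix or suffix with a given property

-- Both `[]` and `w` itself occur as `u` and as `v`, so the two ends of a path are covered.
NoPrefix NoSuffix : {A : Set} → (List A → Set) → List A → Set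
NoPrefix D w = ∀ u v → w ≡ u ++ v → ¬ D u
NoSuffix D w = ∀ u v → w ≡ u ++ v → ¬ D v

module _ {A : Set} where

  -- Once `s ∷ []` is known to fail, the prefixes of `s ∷ w` are tested as prefixes of `w` under
  -- `D ∘ (s ∷_)`. That `D []` fails guarantees a last step to split off.
  shortestPrefix : {D : List A → Set} → Decidable D → ¬ D [] → ∀ w →
    NoPrefix D w ⊎
    ∃ λ p → ∃ λ s → ∃ λ q → w ≡ p ++ s ∷ q × NoPrefix D p × D (p ++ s ∷ [])
  shortestPrefix D? ¬d [] = inj₁ λ { [] [] refl → ¬d }
  shortestPrefix {D} D? ¬d (s ∷ w) with D? (s ∷ [])
  ... | yes d = inj₂ ([] , s , w , refl , (λ { [] [] refl → ¬d }) , d)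
  ... | no ¬ds with shortestPrefix (D? ∘ (s ∷_)) ¬ds w
  ... | inj₁ none = inj₁ λ { [] _ _ → ¬d ; (_ ∷ u) v refl → none u v refl }
  ... | inj₂ (p , s′ , q , refl , none , d) =
    inj₂ (s ∷ p , s′ , q , refl , (λ { [] _ _ → ¬d ; (_ ∷ u) v refl → none u v refl }) , d)

  -- If one cut came earlier, its prefix together with the next step would be a prefix of the other
  -- one satisfying `D`.
  shortestPrefix-unique : {D : List A → Set} → ∀ p p′ {s s′ q q′} →
    p ++ s ∷ q ≡ p′ ++ s′ ∷ q′ → NoPrefix D p → D (p ++ s ∷ []) →
    NoPrefix D p′ → D (p′ ++ s′ ∷ []) → p ≡ p′ × q ≡ q′
  shortestPrefix-unique [] [] refl _ _ _ _ = refl , refl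
  shortestPrefix-unique [] (s ∷ p′) refl _ d none′ _ = ⊥-elim (none′ (s ∷ []) p′ refl d)
  shortestPrefix-unique (s ∷ p) [] refl none _ _ d′ = ⊥-elim (none (s ∷ []) p refl d′)
  shortestPrefix-unique {D} (x ∷ p) (x′ ∷ p′) eq none d none′ d′ with ∷-injective eq
  ... | refl , eq′
    with shortestPrefix-unique {D ∘ (x ∷_)} p p′ eq′
           (λ u v e → none (x ∷ u) v (cong (x ∷_) e)) d
           (λ u v e → none′ (x ∷ u) v (cong (x ∷_) e)) d′
  ... | refl , refl = refl , refl

  -- Searching the tail first makes the suffix found the shortest; `D` stays fixed, since suffixes
  -- of the tail are suffixes of the whole.
  shortestSuffix : {D : List A → Set} → Decidable D → ¬ D [] → ∀ w →
    NoSuffix D w ⊎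
    ∃ λ p → ∃ λ s → ∃ λ q → w ≡ p ++ s ∷ q × NoSuffix D q × D (s ∷ q)
  shortestSuffix D? ¬d [] = inj₁ λ { [] [] refl → ¬d }
  shortestSuffix D? ¬d (s ∷ w) with shortestSuffix D? ¬d w
  ... | inj₂ (p , s′ , q , refl , none , d) = inj₂ (s ∷ p , s′ , q , refl , none , d)
  ... | inj₁ none with D? (s ∷ w)
  ...   | yes d = inj₂ ([] , s , w , refl , none , d)
  ...   | no ¬ds = inj₁ λ { [] _ refl → ¬ds ; (_ ∷ u) v refl → none u v refl }

  shortestSuffix-unique : {D : List A → Set} → ∀ p p′ {s s′ q q′} →
    p ++ s ∷ q ≡ p′ ++ s′ ∷ q′ → NoSuffix D q → D (s ∷ q) →
    NoSuffix D q′ → D (s′ ∷ q′) → p ≡ p′ × q ≡ q′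
  shortestSuffix-unique [] [] refl _ _ _ _ = refl , refl
  shortestSuffix-unique [] (x ∷ p′) refl none _ _ d′ = ⊥-elim (none p′ _ refl d′)
  shortestSuffix-unique (x ∷ p) [] refl _ d none′ _ = ⊥-elim (none′ p _ refl d)
  shortestSuffix-unique (x ∷ p) (x′ ∷ p′) eq none d none′ d′ with ∷-injective eq
  ... | refl , eq′ with shortestSuffix-unique p p′ eq′ none d none′ d′
  ... | refl , refl = refl , refl

-- Counting paths by their numbers of steps and corners

rights ups : Path → ℕ
rights []          = 0
rights (right ∷ w) = suc (rights w)
rights (up ∷ w)    = rights w
ups []          = 0
ups (right ∷ w) = ups w
ups (up ∷ w)    = suc (ups w)

rights-++ : ∀ u v → rights (u ++ v) ≡ rights u + rights v
rights-++ [] v          = refl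
rights-++ (right ∷ u) v = cong suc (rights-++ u v)
rights-++ (up ∷ u) v    = rights-++ u v

ups-++ : ∀ u v → ups (u ++ v) ≡ ups u + ups v
ups-++ [] v          = refl
ups-++ (right ∷ u) v = ups-++ u v
ups-++ (up ∷ u) v    = cong suc (ups-++ u v)

record Shape (f : Path → ℕ) (k l c : ℕ) (w : Path) : Set where
  constructor shape
  field
    rights≡ : rights w ≡ k
    ups≡    : ups w ≡ l
    stat≡   : f w ≡ c

Shape-irrelevant : ∀ {f k l c w} → Nullary.Irrelevant (Shape f k l c w)
Shape-irrelevant (shape r u e) (shape r′ u′ e′)
  with refl ← ℕₚ.≡-irrelevant r r′ | refl ← ℕₚ.≡-irrelevant u u′ | refl ← ℕₚ.≡-irrelevant e e′ = refl

Paths : (Path → ℕ) → ℕ → ℕ → ℕ → Set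
Paths f k l c = Σ Path (Shape f k l c)

-- The steps already read are absorbed into the statistic, so a single recursion on the numbers of
-- steps serves every `f`.
count : (Path → ℕ) → ℕ → ℕ → ℕ → ℕ
count f zero    zero    c = if f [] ℕ.≡ᵇ c then 1 else 0
count f (suc k) zero    c = count (f ∘ (right ∷_)) k zero c
count f zero    (suc l) c = count (f ∘ (up ∷_)) zero l c
count f (suc k) (suc l) c = count (f ∘ (right ∷_)) k (suc l) c + count (f ∘ (up ∷_)) (suc k) l c

Paths↔Fin-count : ∀ f k l c → Paths f k l c ↔ Fin (count f k l c)
Paths↔Fin-count f zero zero c with f [] ℕ.≡ᵇ c in eq
... | true = mk↔ₛ′ (λ _ → fzero) (λ _ → [] , shape refl refl (ℕₚ.≡ᵇ⇒≡ _ _ (subst T (sym eq) tt)))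
  (λ { fzero → refl ; (fsuc ()) })
  (λ { ([] , _) → Σ-≡ Shape-irrelevant refl
     ; (right ∷ _ , shape () _ _) ; (up ∷ _ , shape _ () _) })
... | false = empty↔Fin0 λ
  { ([] , shape _ _ e) → subst T eq (ℕₚ.≡⇒≡ᵇ _ _ e)
  ; (right ∷ _ , shape () _ _)
  ; (up ∷ _ , shape _ () _) }
Paths↔Fin-count f (suc k) zero c = ↔-trans (mk↔ₛ′
  (λ { (right ∷ w , shape r u e) → w , shape (ℕₚ.suc-injective r) u e
     ; ([] , shape () _ _) ; (up ∷ w , shape _ () _) })
  (λ (w , shape r u e) → right ∷ w , shape (cong suc r) u e)
  (λ _ → Σ-≡ Shape-irrelevant refl)
  (λ { (right ∷ w , _) → Σ-≡ Shape-irrelevant refl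
     ; ([] , shape () _ _) ; (up ∷ w , shape _ () _) }))
  (Paths↔Fin-count (f ∘ (right ∷_)) k zero c)
Paths↔Fin-count f zero (suc l) c = ↔-trans (mk↔ₛ′
  (λ { (up ∷ w , shape r u e) → w , shape r (ℕₚ.suc-injective u) e
     ; ([] , shape _ () _) ; (right ∷ w , shape () _ _) })
  (λ (w , shape r u e) → up ∷ w , shape r (cong suc u) e)
  (λ _ → Σ-≡ Shape-irrelevant refl)
  (λ { (up ∷ w , _) → Σ-≡ Shape-irrelevant refl
     ; ([] , shape _ () _) ; (right ∷ w , shape () _ _) }))
  (Paths↔Fin-count (f ∘ (up ∷_)) zero l c)
Paths↔Fin-count f (suc k) (suc l) c = ↔-trans (mk↔ₛ′
  (λ { (right ∷ w , shape r u e) → inj₁ (w , shape (ℕₚ.suc-injective r) u e)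
     ; (up ∷ w , shape r u e) → inj₂ (w , shape r (ℕₚ.suc-injective u) e)
     ; ([] , shape () _ _) })
  (λ { (inj₁ (w , shape r u e)) → right ∷ w , shape (cong suc r) u e
     ; (inj₂ (w , shape r u e)) → up ∷ w , shape r (cong suc u) e })
  (λ { (inj₁ _) → cong inj₁ (Σ-≡ Shape-irrelevant refl)
     ; (inj₂ _) → cong inj₂ (Σ-≡ Shape-irrelevant refl) })
  (λ { (right ∷ w , _) → Σ-≡ Shape-irrelevant refl
     ; (up ∷ w , _) → Σ-≡ Shape-irrelevant refl
     ; ([] , shape () _ _) }))
  (↔-trans (Paths↔Fin-count (f ∘ (right ∷_)) k (suc l) c ⊎-↔ Paths↔Fin-count (f ∘ (up ∷_)) (suc k) l c)
           (↔-sym +↔⊎))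

-- `ruCorners (right ∷ up ∷ w)` unfolds to `suc (ruCorners w)`; this strips the new corner from the
-- count.
count-suc : ∀ f k l c → count (suc ∘ f) k l (suc c) ≡ count f k l c
count-suc f zero    zero    c = refl
count-suc f (suc k) zero    c = count-suc (f ∘ (right ∷_)) k zero c
count-suc f zero    (suc l) c = count-suc (f ∘ (up ∷_)) zero l c
count-suc f (suc k) (suc l) c =
  cong₂ _+_ (count-suc (f ∘ (right ∷_)) k (suc l) c) (count-suc (f ∘ (up ∷_)) (suc k) l c)

count-suc-zero : ∀ f k l → count (suc ∘ f) k l 0 ≡ 0
count-suc-zero f zero    zero    = refl
count-suc-zero f (suc k) zero    = count-suc-zero (f ∘ (right ∷_)) k zero
count-suc-zero f zero    (suc l) = count-suc-zero (f ∘ (up ∷_)) zero l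
count-suc-zero f (suc k) (suc l) =
  cong₂ _+_ (count-suc-zero (f ∘ (right ∷_)) k (suc l)) (count-suc-zero (f ∘ (up ∷_)) (suc k) l)

pascal : ∀ n k → suc n C suc k ≡ n C k + n C suc k
pascal n k = sym (nCk+nC[k+1]≡[n+1]C[k+1] n k)

count-right-flat-0 : ∀ k → count (ruCorners ∘ (right ∷_)) k 0 0 ≡ 1
count-right-flat-0 zero    = refl
count-right-flat-0 (suc k) = count-right-flat-0 k

count-right-flat-suc : ∀ k c → count (ruCorners ∘ (right ∷_)) k 0 (suc c) ≡ 0
count-right-flat-suc zero    c = refl
count-right-flat-suc (suc k) c = count-right-flat-suc k c

count-right-0 : ∀ k l → count (ruCorners ∘ (right ∷_)) k (suc l) 0 ≡ 0
count-right-0 zero    l = count-suc-zero ruCorners zero l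
count-right-0 (suc k) l =
  cong₂ _+_ (count-right-0 k l) (count-suc-zero ruCorners (suc k) l)

-- Corner points (x , y) satisfy 1 ≤ x ≤ k, 0 ≤ y < l, and any c abscissae and
-- c ordinates can be paired up in exactly one way.
count-ruCorners : ∀ k l c → count ruCorners k l c ≡ (k C c) ℕ.* (l C c)
-- The path starts with a right step, so its first up step makes a corner of ordinate 0. The other c
-- ordinates are chosen from l, the c + 1 abscissae from k + 1.
count-right : ∀ k l c →
  count (ruCorners ∘ (right ∷_)) k (suc l) (suc c) ≡ (suc k C suc c) ℕ.* (l C c)

count-ruCorners zero    zero    zero    = refl
count-ruCorners zero    zero    (suc c) = refl
count-ruCorners (suc k) zero    zero    = count-right-flat-0 k
count-ruCorners (suc k) zero    (suc c) =
  trans (count-right-flat-suc k c) (sym (ℕₚ.*-zeroʳ (suc k C suc c)))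
count-ruCorners zero    (suc l) zero    = count-ruCorners zero l zero
count-ruCorners zero    (suc l) (suc c) = count-ruCorners zero l (suc c)
count-ruCorners (suc k) (suc l) zero    =
  cong₂ _+_ (count-right-0 k l) (count-ruCorners (suc k) l zero)
count-ruCorners (suc k) (suc l) (suc c) = begin
  count (ruCorners ∘ (right ∷_)) k (suc l) (suc c) + count ruCorners (suc k) l (suc c)
    ≡⟨ cong₂ _+_ (count-right k l c) (count-ruCorners (suc k) l (suc c)) ⟩
  K ℕ.* (l C c) + K ℕ.* (l C suc c)
    ≡⟨ ℕₚ.*-distribˡ-+ K (l C c) (l C suc c) ⟨
  K ℕ.* (l C c + l C suc c)
    ≡⟨ cong (K ℕ.*_) (pascal l c) ⟨
  K ℕ.* (suc l C suc c) ∎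
  where
  open ≡-Reasoning
  K = suc k C suc c

count-right zero l c = begin
  count (suc ∘ ruCorners) zero l (suc c)  ≡⟨ count-suc ruCorners zero l c ⟩
  count ruCorners zero l c                ≡⟨ count-ruCorners zero l c ⟩
  (0 C c) ℕ.* (l C c)                     ≡⟨ cong (ℕ._* (l C c)) (ℕₚ.+-identityʳ (0 C c)) ⟨
  (0 C c + 0 C suc c) ℕ.* (l C c)         ≡⟨ cong (ℕ._* (l C c)) (pascal 0 c) ⟨
  (1 C suc c) ℕ.* (l C c)                 ∎
  where open ≡-Reasoning
count-right (suc k) l c = begin
  count (ruCorners ∘ (right ∷_)) k (suc l) (suc c) + count (suc ∘ ruCorners) (suc k) l (suc c)
    ≡⟨ cong₂ _+_ (count-right k l c)
         (trans (count-suc ruCorners (suc k) l c) (count-ruCorners (suc k) l c)) ⟩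
  (suc k C suc c) ℕ.* L + (suc k C c) ℕ.* L
    ≡⟨ ℕₚ.*-distribʳ-+ L (suc k C suc c) (suc k C c) ⟨
  (suc k C suc c + suc k C c) ℕ.* L
    ≡⟨ cong (ℕ._* L) (trans (ℕₚ.+-comm (suc k C suc c) (suc k C c)) (sym (pascal (suc k) c))) ⟩
  (suc (suc k) C suc c) ℕ.* L ∎
  where
  open ≡-Reasoning
  L = l C c

ruCorners-up : Path → ℕ
ruCorners-up w = ruCorners (w ++ up ∷ [])

count-up-vertical-0 : ∀ l → count ruCorners-up 0 l 0 ≡ 1
count-up-vertical-0 zero    = refl
count-up-vertical-0 (suc l) = count-up-vertical-0 l

count-up-vertical-suc : ∀ l c → count ruCorners-up 0 l (suc c) ≡ 0
count-up-vertical-suc zero    c = refl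
count-up-vertical-suc (suc l) c = count-up-vertical-suc l c

count-right-up-0 : ∀ k l → count (ruCorners-up ∘ (right ∷_)) k l 0 ≡ 0
count-right-up-0 zero    zero    = refl
count-right-up-0 (suc k) zero    = count-right-up-0 k zero
count-right-up-0 zero    (suc l) = count-suc-zero ruCorners-up zero l
count-right-up-0 (suc k) (suc l) =
  cong₂ _+_ (count-right-up-0 k (suc l)) (count-suc-zero ruCorners-up (suc k) l)

count-up-0 : ∀ k l → count ruCorners-up (suc k) l 0 ≡ 0
count-up-0 k zero    = count-right-up-0 k zero
count-up-0 k (suc l) = cong₂ _+_ (count-right-up-0 k (suc l)) (count-up-0 k l)

-- In `right ∷ w ++ up ∷ []` the first corner has ordinate 0 and the last one abscissa k + 1. There
-- remain c ordinates to choose from l and c abscissae from k.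
count-right-up : ∀ k l c →
  count (ruCorners-up ∘ (right ∷_)) k l (suc c) ≡ (k C c) ℕ.* (l C c)
-- The closing up step forces only the last abscissa, k + 1; the c + 1 ordinates are free among 0,
-- ..., l.
count-up : ∀ k l c →
  count ruCorners-up (suc k) l (suc c) ≡ (k C c) ℕ.* (suc l C suc c)

count-right-up zero    zero    zero    = refl
count-right-up zero    zero    (suc c) = refl
count-right-up (suc k) zero    zero    = count-right-up k zero zero
count-right-up (suc k) zero    (suc c) = begin
  count (ruCorners-up ∘ (right ∷_)) k zero (suc (suc c))  ≡⟨ count-right-up k zero (suc c) ⟩
  (k C suc c) ℕ.* 0                                       ≡⟨ ℕₚ.*-zeroʳ (k C suc c) ⟩
  0                                                       ≡⟨ ℕₚ.*-zeroʳ (suc k C suc c) ⟨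
  (suc k C suc c) ℕ.* 0                                   ∎
  where open ≡-Reasoning
count-right-up zero    (suc l) zero    =
  trans (count-suc ruCorners-up zero l 0) (count-up-vertical-0 l)
count-right-up zero    (suc l) (suc c) =
  trans (count-suc ruCorners-up zero l (suc c)) (count-up-vertical-suc l c)
count-right-up (suc k) (suc l) zero    =
  cong₂ _+_ (count-right-up k (suc l) zero)
    (trans (count-suc ruCorners-up (suc k) l 0) (count-up-0 k l))
count-right-up (suc k) (suc l) (suc c) = begin
  count (ruCorners-up ∘ (right ∷_)) k (suc l) (suc (suc c)) +
  count (suc ∘ ruCorners-up) (suc k) l (suc (suc c))
    ≡⟨ cong₂ _+_ (count-right-up k (suc l) (suc c))
         (trans (count-suc ruCorners-up (suc k) l (suc c)) (count-up k l c)) ⟩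
  (k C suc c) ℕ.* L + (k C c) ℕ.* L
    ≡⟨ ℕₚ.*-distribʳ-+ L (k C suc c) (k C c) ⟨
  (k C suc c + k C c) ℕ.* L
    ≡⟨ cong (ℕ._* L) (trans (ℕₚ.+-comm (k C suc c) (k C c)) (sym (pascal k c))) ⟩
  (suc k C suc c) ℕ.* L ∎
  where
  open ≡-Reasoning
  L = suc l C suc c

count-up k zero c = begin
  count (ruCorners-up ∘ (right ∷_)) k zero (suc c)  ≡⟨ count-right-up k zero c ⟩
  (k C c) ℕ.* (0 C c)                               ≡⟨ cong ((k C c) ℕ.*_) (ℕₚ.+-identityʳ (0 C c)) ⟨
  (k C c) ℕ.* (0 C c + 0 C suc c)                   ≡⟨ cong ((k C c) ℕ.*_) (pascal 0 c) ⟨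
  (k C c) ℕ.* (1 C suc c)                           ∎
  where open ≡-Reasoning
count-up k (suc l) c = begin
  count (ruCorners-up ∘ (right ∷_)) k (suc l) (suc c) + count ruCorners-up (suc k) l (suc c)
    ≡⟨ cong₂ _+_ (count-right-up k (suc l) c) (count-up k l c) ⟩
  K ℕ.* (suc l C c) + K ℕ.* (suc l C suc c)
    ≡⟨ ℕₚ.*-distribˡ-+ K (suc l C c) (suc l C suc c) ⟨
  K ℕ.* (suc l C c + suc l C suc c)
    ≡⟨ cong (K ℕ.*_) (pascal (suc l) c) ⟨
  K ℕ.* (suc (suc l) C suc c) ∎
  where
  open ≡-Reasoning
  K = k C c

-- A right step put in front turns the virtual corner into a real one, so `ruCorners ∘ (right ∷_)`
-- can stand for `corners` from here on.
corners≡ruCorners-right : ∀ w → corners w ≡ ruCorners (right ∷ w)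
corners≡ruCorners-right []          = refl
corners≡ruCorners-right (right ∷ w) = refl
corners≡ruCorners-right (up ∷ w)    = refl

-- A corner consists of an up step and the step before it, so a cut right after an up step destroys
-- none.
ruCorners-++-up : ∀ x y → ruCorners (x ++ up ∷ y) ≡ ruCorners-up x + ruCorners y
ruCorners-++-up []                  y = refl
ruCorners-++-up (up ∷ x)            y = ruCorners-++-up x y
ruCorners-++-up (right ∷ [])        y = refl
ruCorners-++-up (right ∷ up ∷ x)    y = cong suc (ruCorners-++-up x y)
ruCorners-++-up (right ∷ right ∷ x) y = ruCorners-++-up (right ∷ x) y

-- A cut right before a right step destroys no corner either, as no corner has its up step there.
ruCorners-++-right : ∀ x y → ruCorners (x ++ right ∷ y) ≡ ruCorners x + ruCorners (right ∷ y)
ruCorners-++-right []                  y = refl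
ruCorners-++-right (up ∷ x)            y = ruCorners-++-right x y
ruCorners-++-right (right ∷ [])        y = refl
ruCorners-++-right (right ∷ up ∷ x)    y = cong suc (ruCorners-++-right x y)
ruCorners-++-right (right ∷ right ∷ x) y = ruCorners-++-right (right ∷ x) y

-- The words right ∷ p ++ up ∷ q and q ++ right ∷ p ++ up ∷ [] are rotations of each
-- other, and neither has a corner where it wraps around.
corners-swap : ∀ p q → ruCorners-up (q ++ right ∷ p) ≡ ruCorners (right ∷ p ++ up ∷ q)
corners-swap p q = begin
  ruCorners ((q ++ right ∷ p) ++ up ∷ [])    ≡⟨ cong ruCorners (++-assoc q (right ∷ p) (up ∷ [])) ⟩
  ruCorners (q ++ right ∷ p ++ up ∷ [])      ≡⟨ ruCorners-++-right q (p ++ up ∷ []) ⟩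
  ruCorners q + ruCorners-up (right ∷ p)     ≡⟨ ℕₚ.+-comm (ruCorners q) _ ⟩
  ruCorners-up (right ∷ p) + ruCorners q     ≡⟨ ruCorners-++-up (right ∷ p) q ⟨
  ruCorners (right ∷ p ++ up ∷ q)            ∎
  where open ≡-Reasoning

rights-swap : ∀ p q → rights (q ++ right ∷ p) ≡ suc (rights (p ++ up ∷ q))
rights-swap p q = begin
  rights (q ++ right ∷ p)       ≡⟨ rights-++ q (right ∷ p) ⟩
  rights q + suc (rights p)     ≡⟨ ℕₚ.+-comm (rights q) _ ⟩
  suc (rights p + rights q)     ≡⟨ cong suc (rights-++ p (up ∷ q)) ⟨
  suc (rights (p ++ up ∷ q))    ∎
  where open ≡-Reasoning

ups-swap : ∀ p q → suc (ups (q ++ right ∷ p)) ≡ ups (p ++ up ∷ q)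
ups-swap p q = begin
  suc (ups (q ++ right ∷ p))    ≡⟨ cong suc (ups-++ q (right ∷ p)) ⟩
  suc (ups q) + ups p           ≡⟨ ℕₚ.+-comm (suc (ups q)) _ ⟩
  ups p + suc (ups q)           ≡⟨ ups-++ p (up ∷ q) ⟨
  ups (p ++ up ∷ q)             ∎
  where open ≡-Reasoning

swap-shape : ∀ {k l c} p q → Shape (ruCorners ∘ (right ∷_)) k (suc l) c (p ++ up ∷ q) →
  Shape ruCorners-up (suc k) l c (q ++ right ∷ p)
swap-shape p q (shape r u e) = shape (trans (rights-swap p q) (cong suc r))
  (ℕₚ.suc-injective (trans (ups-swap p q) u)) (trans (corners-swap p q) e)

unswap-shape : ∀ {k l c} p q → Shape ruCorners-up (suc k) l c (q ++ right ∷ p) →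
  Shape (ruCorners ∘ (right ∷_)) k (suc l) c (p ++ up ∷ q)
unswap-shape p q (shape r u e) = shape (ℕₚ.suc-injective (trans (sym (rights-swap p q)) r))
  (trans (sym (ups-swap p q)) (cong suc u)) (trans (sym (corners-swap p q)) e)

-- The number of bad pairs per boundary unit. A path of height 0 has no up step that could cross the
-- boundary.
badShapes : ℕ → ℕ → ℕ → ℕ
badShapes k zero    c = 0
badShapes k (suc l) c = count ruCorners-up (suc k) l c

-- Domination in terms of prefixes, and partial sums

endFrom≡ : ∀ x y w → endFrom (x , y) w ≡ (x + rights w , y + ups w)
endFrom≡ x y []          = sym (cong₂ _,_ (ℕₚ.+-identityʳ x) (ℕₚ.+-identityʳ y))
endFrom≡ x y (right ∷ w) = trans (endFrom≡ (suc x) y w) (cong (_, y + ups w) (sym (ℕₚ.+-suc x _)))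
endFrom≡ x y (up ∷ w)    = trans (endFrom≡ x (suc y) w) (cong (x + rights w ,_) (sym (ℕₚ.+-suc y _)))

endpoint≡ : ∀ w → endpoint w ≡ (rights w , ups w)
endpoint≡ = endFrom≡ 0 0

-- The lattice points on a path are the endpoints of its prefixes, so domination becomes a condition
-- on the ways to cut the word.
All-pointsFrom⇒prefixes : ∀ {P : Point → Set} p w → All P (pointsFrom p w) →
  ∀ u v → w ≡ u ++ v → P (endFrom p u)
All-pointsFrom⇒prefixes p []      (px ∷ _)   []      v eq   = px
All-pointsFrom⇒prefixes p (s ∷ w) (px ∷ _)   []      v eq   = px
All-pointsFrom⇒prefixes p (s ∷ w) (_ ∷ pxs)  (_ ∷ u) v refl = All-pointsFrom⇒prefixes (move p s) w pxs u v refl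

prefixes⇒All-pointsFrom : ∀ {P : Point → Set} p w →
  (∀ u v → w ≡ u ++ v → P (endFrom p u)) → All P (pointsFrom p w)
prefixes⇒All-pointsFrom p []      h = h [] [] refl ∷ []
prefixes⇒All-pointsFrom p (s ∷ w) h = h [] (s ∷ w) refl ∷
  prefixes⇒All-pointsFrom (move p s) w (λ u v eq → h (s ∷ u) v (cong (s ∷_) eq))

dominated⇒prefixes : ∀ {m b} w → Dominated m b w →
  ∀ u v → w ≡ u ++ v → DominatedPt m b (rights u , ups u)
dominated⇒prefixes {m} {b} w d u v eq =
  subst (DominatedPt m b) (endpoint≡ u) (All-pointsFrom⇒prefixes _ w d u v eq)

prefixes⇒dominated : ∀ {m b} w → (∀ u v → w ≡ u ++ v → DominatedPt m b (rights u , ups u)) →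
  Dominated m b w
prefixes⇒dominated {m} {b} w h = prefixes⇒All-pointsFrom _ w
  (λ u v eq → subst (DominatedPt m b) (sym (endpoint≡ u)) (h u v eq))

sumTo-cong : ∀ {f g : ℕ → ℕ} → (∀ i → f i ≡ g i) → ∀ d → sumTo f d ≡ sumTo g d
sumTo-cong f≗g zero    = refl
sumTo-cong f≗g (suc d) = cong₂ _+_ (sumTo-cong f≗g d) (f≗g d)

sumTo-+ : ∀ f y d → sumTo f (y + d) ≡ sumTo f y + sumTo (λ i → f (y + i)) d
sumTo-+ f y zero    = trans (cong (sumTo f) (ℕₚ.+-identityʳ y)) (sym (ℕₚ.+-identityʳ _))
sumTo-+ f y (suc d) = begin
  sumTo f (y + suc d)                                  ≡⟨ cong (sumTo f) (ℕₚ.+-suc y d) ⟩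
  sumTo f (y + d) + f (y + d)                          ≡⟨ cong (_+ f (y + d)) (sumTo-+ f y d) ⟩
  sumTo f y + sumTo (λ i → f (y + i)) d + f (y + d)    ≡⟨ ℕₚ.+-assoc (sumTo f y) _ _ ⟩
  sumTo f y + (sumTo (λ i → f (y + i)) d + f (y + d))  ∎
  where open ≡-Reasoning

<-exchange : ∀ {x y s t} → x + y ≡ s + t → x < s → t < y
<-exchange {x} {y} {s} {t} eq x<s = ℕₚ.+-cancelˡ-< s t y
  (subst (_< s + y) eq (ℕₚ.+-monoˡ-< y x<s))

-- Indices modulo m

module _ (m : ℕ) .{{m≢0 : NonZero m}} where

  infix 4 _≈_
  _≈_ : ℕ → ℕ → Set
  x ≈ y = x % m ≡ y % m

  +-cong-≈ : ∀ {x y x′ y′} → x ≈ y → x′ ≈ y′ → x + x′ ≈ y + y′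
  +-cong-≈ {x} {y} {x′} {y′} p q = begin
    (x + x′) % m          ≡⟨ %-distribˡ-+ x x′ m ⟩
    (x % m + x′ % m) % m  ≡⟨ cong₂ (λ s t → (s + t) % m) p q ⟩
    (y % m + y′ % m) % m  ≡⟨ %-distribˡ-+ y y′ m ⟨
    (y + y′) % m          ∎
    where open ≡-Reasoning

  -- Adding `z * pred m` on both sides completes `z` to a multiple of m.
  +-cancelʳ-≈ : ∀ {x y} z → x + z ≈ y + z → x ≈ y
  +-cancelʳ-≈ {x} {y} z p = begin
    x % m                      ≡⟨ absorb x ⟩
    (x + z + z ℕ.* pred m) % m ≡⟨ +-cong-≈ p refl ⟩
    (y + z + z ℕ.* pred m) % m ≡⟨ absorb y ⟨
    y % m                      ∎
    where
    open ≡-Reasoning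
    absorb : ∀ w → w ≈ w + z + z ℕ.* pred m
    absorb w = begin
      w % m                         ≡⟨ [m+kn]%n≡m%n w z m ⟨
      (w + z ℕ.* m) % m             ≡⟨ cong (λ t → (w + z ℕ.* t) % m) (ℕₚ.suc-pred m) ⟨
      (w + z ℕ.* suc (pred m)) % m  ≡⟨ cong (λ t → (w + t) % m) (ℕₚ.*-suc z (pred m)) ⟩
      (w + (z + z ℕ.* pred m)) % m  ≡⟨ cong (_% m) (ℕₚ.+-assoc w z _) ⟨
      (w + z + z ℕ.* pred m) % m    ∎

  -- i − j mod m, so that shift m a j i is a (reflect i j)
  reflect : ℕ → Fin m → Fin m
  reflect i j = fromℕ< (m%n<n (i + (m ∸ toℕ j)) m)

  reflect-+ : ∀ i j → toℕ (reflect i j) + toℕ j ≈ i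
  reflect-+ i j = begin
    (toℕ (reflect i j) + toℕ j) % m             ≡⟨ cong (λ t → (t + toℕ j) % m) (toℕ-fromℕ< _) ⟩
    ((i + (m ∸ toℕ j)) % m + toℕ j) % m         ≡⟨ +-cong-≈ (m%n%n≡m%n (i + (m ∸ toℕ j)) m) refl ⟩
    (i + (m ∸ toℕ j) + toℕ j) % m               ≡⟨ cong (_% m) (ℕₚ.+-assoc i _ _) ⟩
    (i + (m ∸ toℕ j + toℕ j)) % m               ≡⟨ cong (λ t → (i + t) % m) (ℕₚ.m∸n+n≡m (ℕₚ.<⇒≤ (toℕ<n j))) ⟩
    (i + m) % m                                 ≡⟨ [m+n]%n≡m%n i m ⟩
    i % m                                       ∎
    where open ≡-Reasoning

  reflect-unique : ∀ {i} {r j : Fin m} → toℕ r + toℕ j ≈ i → r ≡ reflect i j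
  reflect-unique {i} {r} {j} p = toℕ-injective (begin
    toℕ r                  ≡⟨ m<n⇒m%n≡m (toℕ<n r) ⟨
    toℕ r % m              ≡⟨ +-cancelʳ-≈ (toℕ j) (trans p (sym (reflect-+ i j))) ⟩
    toℕ (reflect i j) % m  ≡⟨ m<n⇒m%n≡m (toℕ<n (reflect i j)) ⟩
    toℕ (reflect i j)      ∎)
    where open ≡-Reasoning

  reflect-involutive : ∀ i j → reflect i (reflect i j) ≡ j
  reflect-involutive i j = sym (reflect-unique
    (trans (cong (_% m) (ℕₚ.+-comm (toℕ j) _)) (reflect-+ i j)))

  -- As residues, i - (d - (y + d - j)) = y + i - j. Adding v + s on both sides lets each `reflect`
  -- meet the argument it cancels with.
  reflect-+-reflect : ∀ y d i j → reflect (y + i) j ≡ reflect i (reflect d (reflect (y + d) j))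
  reflect-+-reflect y d i j = sym (reflect-unique (+-cancelʳ-≈ (toℕ v + toℕ s) (begin
    (toℕ w + toℕ j + (toℕ v + toℕ s)) % m    ≡⟨ cong (_% m) (rearrange₁ (toℕ w) (toℕ j) (toℕ v) (toℕ s)) ⟩
    (toℕ w + toℕ v + (toℕ s + toℕ j)) % m    ≡⟨ +-cong-≈ (reflect-+ i v) (reflect-+ (y + d) j) ⟩
    (i + (y + d)) % m                        ≡⟨ cong (_% m) (rearrange₂ i y d) ⟩
    (y + i + d) % m                          ≡⟨ +-cong-≈ {y + i} refl (sym (reflect-+ d s)) ⟩
    (y + i + (toℕ v + toℕ s)) % m            ∎)))
    where
    open ≡-Reasoning
    open +-*-Solver
    s = reflect (y + d) j
    v = reflect d s
    w = reflect i v
    rearrange₁ : ∀ w j v s → w + j + (v + s) ≡ w + v + (s + j)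
    rearrange₁ = solve 4 (λ w j v s → w :+ j :+ (v :+ s) := w :+ v :+ (s :+ j)) refl
    rearrange₂ : ∀ i y d → i + (y + d) ≡ y + i + d
    rearrange₂ = solve 3 (λ i y d → i :+ (y :+ d) := y :+ i :+ d) refl

  -- The boundary read from either end, and its crossings

  module _ (a : Fin m → ℕ) where

    -- sum of the d parts cyclically preceding a_r
    sumBefore : Fin m → ℕ → ℕ
    sumBefore r d = sumTo (shift m a (reflect d r)) d

    -- The last d of the y + d parts depend only on the index where they stop, so the boundary can
    -- be laid backwards from the end of a path.
    sumTo-shift-+ : ∀ j y d → sumTo (shift m a j) (y + d) ≡
      sumTo (shift m a j) y + sumBefore (reflect (y + d) j) d
    sumTo-shift-+ j y d = trans (sumTo-+ (shift m a j) y d)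
      (cong (sumTo (shift m a j) y ℕ.+_) (sumTo-cong (λ i → cong a (reflect-+-reflect y d i j)) d))

    sumBefore-+-part : ∀ r d → sumBefore r d + a r ≡ sumTo (shift m a (reflect d r)) (suc d)
    sumBefore-+-part r d = cong (λ s → sumBefore r d + a s) (sym (reflect-involutive d r))

    -- This negates only the second half of `DominatedPt`; the bound on the height returns in
    -- `good↔dominated`.
    Under : Fin m → Path → Set
    Under j w = rights w < sumTo (shift m a j) (ups w)

    -- the start of w lies strictly to the left of the boundary that ends at the end of w
    -- with offset o into the part a_r
    Past : Fin m → ℕ → Path → Set
    Past r o w = o + sumBefore r (ups w) < rights w

    Under? : ∀ j → Decidable (Under j)
    Under? j w = rights w ℕ.<? sumTo (shift m a j) (ups w)

    Past? : ∀ r o → Decidable (Past r o)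
    Past? r o w = o + sumBefore r (ups w) ℕ.<? rights w

    module _ (j : Fin m) (o : ℕ) (u v : Path)
      (eq : rights (u ++ v) ≡ o + sumTo (shift m a j) (ups (u ++ v))) where

      private
        r = reflect (ups (u ++ v)) j
        balance : rights u + rights v ≡ sumTo (shift m a j) (ups u) + (o + sumBefore r (ups v))
        balance = begin
          rights u + rights v          ≡⟨ rights-++ u v ⟨
          rights (u ++ v)              ≡⟨ eq ⟩
          o + S (ups (u ++ v))         ≡⟨ cong (λ t → o + S t) (ups-++ u v) ⟩
          o + S (ups u + ups v)        ≡⟨ cong (o ℕ.+_) (sumTo-shift-+ j (ups u) (ups v)) ⟩
          o + (S (ups u) + sumBefore (reflect (ups u + ups v) j) (ups v))
            ≡⟨ cong (λ t → o + (S (ups u) + sumBefore (reflect t j) (ups v))) (ups-++ u v) ⟨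
          o + (S (ups u) + sumBefore r (ups v))
            ≡⟨ solve 3 (λ o s t → o :+ (s :+ t) := s :+ (o :+ t)) refl o (S (ups u)) _ ⟩
          S (ups u) + (o + sumBefore r (ups v)) ∎
          where
          open ≡-Reasoning
          open +-*-Solver
          S = sumTo (shift m a j)

      -- The end of `u ++ v` lies exactly o to the right of the boundary. A shortage of right steps
      -- before the cut is therefore an excess after it.
      Under⇒Past : Under j u → Past r o v
      Under⇒Past = <-exchange balance

      Past⇒Under : Past r o v → Under j u
      Past⇒Under = <-exchange
        (trans (ℕₚ.+-comm (o + sumBefore r (ups v)) _) (trans (sym balance) (ℕₚ.+-comm (rights u) _)))

    -- The second component is `Under j (p ++ up ∷ [])` with the appended step computed away: the
    -- next up step leaves the dominated region.
    CrossesUp : Fin m → Path → Set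
    CrossesUp j p = NoPrefix (Under j) p × rights p < sumTo (shift m a j) (suc (ups p))

    -- The mirror image, read from the end of the word: the right step before `p` is the first to
    -- get past the reversed boundary.
    CrossesRight : Fin m → ℕ → Path → Set
    CrossesRight r o p = NoSuffix (Past r o) p × Past r o (right ∷ p)

    module _ (j : Fin m) (p : Path) (crosses : CrossesUp j p) where

      private
        S = sumTo (shift m a j)
        S≤rights : S (ups p) ≤ rights p
        S≤rights = ℕₚ.≮⇒≥ (proj₁ crosses p [] (sym (++-identityʳ p)))

      row : Fin m
      row = reflect (ups p) j

      -- The slack at the end of `p` tells which unit of the run `a row` the up step crosses.
      offset : ℕ
      offset = rights p ∸ S (ups p)

      rights≡offset+ : rights p ≡ offset + S (ups p)
      rights≡offset+ = sym (ℕₚ.m∸n+n≡m S≤rights)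

      offset<part : offset < a row
      offset<part = ℕₚ.+-cancelˡ-< (S (ups p)) _ _
        (subst (_< S (suc (ups p))) (trans rights≡offset+ (ℕₚ.+-comm offset _)) (proj₂ crosses))

      crossesRight : CrossesRight row offset p
      crossesRight =
        (λ { u v refl past → proj₁ crosses u v refl (Past⇒Under j offset u v rights≡offset+ past) }) ,
        -- Laid backwards from the end of `p`, the boundary arrives exactly at its start, so one
        -- more right step lies strictly past it.
        s≤s (ℕₚ.≤-reflexive (trans
          (cong (λ s → offset + sumTo (shift m a s) (ups p)) (reflect-involutive (ups p) j))
          (sym rights≡offset+)))

    module _ (r : Fin m) (o : ℕ) (o<a : o < a r) (p : Path) (crosses : CrossesRight r o p) where

      start : Fin m
      start = reflect (ups p) r

      private
        row≡ : reflect (ups p) start ≡ r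
        row≡ = reflect-involutive (ups p) r
        eq : rights p ≡ o + sumTo (shift m a start) (ups p)
        -- `p` is not past the boundary but `right ∷ p` is, which leaves only equality.
        eq = ℕₚ.≤-antisym (ℕₚ.≮⇒≥ (proj₁ crosses [] p refl)) (ℕₚ.≤-pred (proj₂ crosses))

      crossesUp : CrossesUp start p
      crossesUp = (λ { u v refl under → proj₁ crosses u v refl
                         (subst (λ r → Past r o v) row≡ (Under⇒Past start o u v eq under)) })
        , subst (_< sumTo (shift m a start) (suc (ups p))) (sym eq)
            (subst (o + sumBefore r (ups p) <_) (sumBefore-+-part r (ups p))
              (subst (o + sumBefore r (ups p) <_) (ℕₚ.+-comm (a r) _) (ℕₚ.+-monoˡ-< _ o<a)))

      row-start : row start p crossesUp ≡ r
      row-start = row≡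

      offset-start : offset start p crossesUp ≡ o
      offset-start = trans (cong (_∸ S) eq) (ℕₚ.m+n∸n≡m o S)
        where S = sumTo (shift m a start) (ups p)

    -- Good and bad pairs

    LPBP : (Fin m → Path → Set) → ℕ → ℕ → ℕ → Set
    LPBP X k l c = Σ (Fin m × Path) λ (j , w) → Shape (ruCorners ∘ (right ∷_)) k l c w × X j w

    -- As a negation it has at most one proof, so a bad pair carries no chosen cut; the cut is
    -- recorded separately in `Crossing`.
    Bad : Fin m → Path → Set
    Bad j w = ¬ NoPrefix (Under j) w

    NoUnder? : ∀ j w → Dec (NoPrefix (Under j) w)
    NoUnder? j w with shortestPrefix (Under? j) (λ ()) w
    ... | inj₁ none = yes none
    ... | inj₂ (p , s , q , refl , _ , under) =
      no λ none → none (p ++ s ∷ []) q (sym (++-assoc p (s ∷ []) q)) under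

    good⊎bad↔all : ∀ k l c →
      (LPBP (NoPrefix ∘ Under) k l c ⊎ LPBP Bad k l c) ↔ (Fin m × Paths (ruCorners ∘ (right ∷_)) k l c)
    good⊎bad↔all k l c = mk↔ₛ′ to from to∘from from∘to
      where
      G = LPBP (NoPrefix ∘ Under) k l c ⊎ LPBP Bad k l c
      to : G → Fin m × Paths (ruCorners ∘ (right ∷_)) k l c
      to (inj₁ ((j , w) , s , _)) = j , w , s
      to (inj₂ ((j , w) , s , _)) = j , w , s
      from : Fin m × Paths (ruCorners ∘ (right ∷_)) k l c → G
      from (j , w , s) with NoUnder? j w
      ... | yes good = inj₁ ((j , w) , s , good)
      ... | no bad   = inj₂ ((j , w) , s , bad)
      to∘from : ∀ x → to (from x) ≡ x
      to∘from (j , w , s) with NoUnder? j w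
      ... | yes _ = refl
      ... | no _  = refl
      from∘to : ∀ x → from (to x) ≡ x
      from∘to (inj₁ ((j , w) , s , good)) with NoUnder? j w
      ... | yes _ = refl
      ... | no bad = ⊥-elim (bad good)
      from∘to (inj₂ ((j , w) , s , bad)) with NoUnder? j w
      ... | yes good = ⊥-elim (bad good)
      ... | no _ = refl

    record Crossing (k l c : ℕ) (x : Fin m × Path × Path) : Set where
      constructor crossing
      p = proj₁ (proj₂ x)
      q = proj₂ (proj₂ x)
      field
        joined  : Shape (ruCorners ∘ (right ∷_)) k l c (p ++ up ∷ q)
        crosses : CrossesUp (proj₁ x) p

    crossing-irrelevant : ∀ {k l c x} → Nullary.Irrelevant (Crossing k l c x)
    crossing-irrelevant (crossing s (none , below)) (crossing s′ (none′ , below′)) =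
      cong₂ (λ s b → crossing s (none , b)) (Shape-irrelevant s s′) (ℕₚ.≤-irrelevant below below′)

    Crossings : ℕ → ℕ → ℕ → Set
    Crossings k l c = Σ (Fin m × Path × Path) (Crossing k l c)

    -- A right step increases the abscissa at constant height, so the first violation comes with an
    -- up step. That first cut is unique.
    crossings↔bad : ∀ k l c → Crossings k l c ↔ LPBP Bad k l c
    crossings↔bad k l c = injective∧surjective⇒↔ join join-injective join-surjective
      where
      Under-∷ʳ : ∀ j p → Under j (p ++ up ∷ []) ≡ (rights p < sumTo (shift m a j) (suc (ups p)))
      Under-∷ʳ j p = cong₂ (λ x y → x < sumTo (shift m a j) y)
        (trans (rights-++ p _) (ℕₚ.+-identityʳ _)) (trans (ups-++ p _) (ℕₚ.+-comm (ups p) 1))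
      Under-right : ∀ {j} p → Under j (p ++ right ∷ []) → Under j p
      Under-right {j} p under = ℕₚ.≤-<-trans
        (subst (rights p ≤_) (sym (rights-++ p _)) (ℕₚ.m≤m+n _ _))
        (subst (λ y → rights (p ++ right ∷ []) < sumTo (shift m a j) y)
          (trans (ups-++ p _) (ℕₚ.+-identityʳ _)) under)
      join : Crossings k l c → LPBP Bad k l c
      join ((j , p , q) , crossing s (none , below)) = (j , p ++ up ∷ q) , s , λ good →
        good (p ++ up ∷ []) q (sym (++-assoc p (up ∷ []) q)) (subst id (sym (Under-∷ʳ j p)) below)
      join-injective : ∀ {x y} → join x ≡ join y → x ≡ y
      join-injective {(j , p , q) , crossing s (none , below)}
                     {(j′ , p′ , q′) , crossing s′ (none′ , below′)} eq
        with ,-injective (cong proj₁ eq)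
      ... | refl , eq′
        with shortestPrefix-unique {D = Under j} p p′ eq′
               none (subst id (sym (Under-∷ʳ j p)) below) none′ (subst id (sym (Under-∷ʳ j p′)) below′)
      ... | refl , refl = Σ-≡ crossing-irrelevant refl
      join-surjective : ∀ y → ∃ λ x → join x ≡ y
      join-surjective ((j , w) , s , bad) with shortestPrefix (Under? j) (λ ()) w
      ... | inj₁ good = ⊥-elim (bad good)
      ... | inj₂ (p , up , q , refl , none , under) =
        ((j , p , q) , crossing s (none , subst id (Under-∷ʳ j p) under)) , refl
      ... | inj₂ (p , right , q , refl , none , under) =
        ⊥-elim (none p [] (sym (++-identityʳ p)) (Under-right {j} p under))

    -- Both sums stop just before `a r`; the longer one starts one part earlier, hence the split
    -- after its first part.
    sumBefore-suc : ∀ r d → sumBefore r d ≤ sumBefore r (suc d)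
    sumBefore-suc r d = subst (sumBefore r d ≤_) (sym eq) (ℕₚ.m≤n+m _ _)
      where
      j = reflect (suc d) r
      eq : sumBefore r (suc d) ≡ sumTo (shift m a j) 1 + sumBefore r d
      eq = trans (sumTo-shift-+ j 1 d)
        (cong (λ s → sumTo (shift m a j) 1 + sumBefore s d) (reflect-involutive (suc d) r))

    module _ {k l : ℕ} (dominated : ∀ j → sumTo (shift m a j) (suc l) ≤ k) where

      -- Equal images give one word with one predicate `Past`, whose cut at the shortest suffix is
      -- unique. Such a cut exists because every shift dominates (k , l).
      crossings↔marked : ∀ c →
        Crossings k (suc l) c ↔ (Σ (Fin m) (Fin ∘ a) × Paths ruCorners-up (suc k) l c)
      crossings↔marked c = injective∧surjective⇒↔ swap swap-injective swap-surjective
        where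
        Marked = Σ (Fin m) (Fin ∘ a) × Paths ruCorners-up (suc k) l c
        swap : Crossings k (suc l) c → Marked
        swap ((j , p , q) , crossing s crosses) =
          (row j p crosses , fromℕ< (offset<part j p crosses)) , q ++ right ∷ p , swap-shape p q s
        swap-injective : ∀ {x y} → swap x ≡ swap y → x ≡ y
        swap-injective {(j , p , q) , crossing s cr} {(j′ , p′ , q′) , crossing s′ cr′} eq =
          Σ-≡ crossing-irrelevant same
          where
          row-eq : row j p cr ≡ row j′ p′ cr′
          row-eq = cong (proj₁ ∘ proj₁) eq
          offset-eq : offset j p cr ≡ offset j′ p′ cr′
          offset-eq = trans (sym (toℕ-fromℕ< _)) (trans (cong (λ ((_ , o) , _) → toℕ o) eq) (toℕ-fromℕ< _))
          right′ : CrossesRight (row j p cr) (offset j p cr) p′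
          right′ = subst₂ (λ r o → CrossesRight r o p′) (sym row-eq) (sym offset-eq) (crossesRight j′ p′ cr′)
          words : q ≡ q′ × p ≡ p′
          words = shortestSuffix-unique {D = Past (row j p cr) (offset j p cr)} q q′ (cong (proj₁ ∘ proj₂) eq)
            (proj₁ (crossesRight j p cr)) (proj₂ (crossesRight j p cr)) (proj₁ right′) (proj₂ right′)
          same : (j , p , q) ≡ (j′ , p′ , q′)
          -- For a fixed `p`, `reflect (ups p)` turns the common row back into the shift.
          same with refl , refl ← words = cong (_, p , q) (begin
            j                                ≡⟨ reflect-involutive (ups p) j ⟨
            reflect (ups p) (row j p cr)     ≡⟨ cong (reflect (ups p)) row-eq ⟩
            reflect (ups p) (row j′ p cr′)   ≡⟨ reflect-involutive (ups p) j′ ⟩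
            j′                               ∎)
            where open ≡-Reasoning
        marked-≡ : ∀ {r r′ : Fin m} {o : Fin (a r)} {o′ : Fin (a r′)} {w : Path} {s s′} →
          r ≡ r′ → toℕ o ≡ toℕ o′ → _≡_ {A = Marked} ((r , o) , w , s) ((r′ , o′) , w , s′)
        marked-≡ refl o≡o′ with refl ← toℕ-injective o≡o′ = cong (_ ,_) (Σ-≡ Shape-irrelevant refl)
        -- The l parts before `a r`, together with `a r` itself, are all l + 1 parts below the end
        -- of some shifted boundary, so their sum is at most k, whereas `w` has k + 1 right steps.
        past : ∀ r (o : Fin (a r)) w → rights w ≡ suc k → ups w ≡ l → Past r (toℕ o) w
        past r o w r≡ u≡ = subst₂ (λ y x → toℕ o + sumBefore r y < x) (sym u≡) (sym r≡) (s≤s (begin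
          toℕ o + sumBefore r l                        ≤⟨ ℕₚ.+-monoˡ-≤ _ (ℕₚ.<⇒≤ (toℕ<n o)) ⟩
          a r + sumBefore r l                          ≡⟨ ℕₚ.+-comm (a r) _ ⟩
          sumBefore r l + a r                          ≡⟨ sumBefore-+-part r l ⟩
          sumTo (shift m a (reflect l r)) (suc l)      ≤⟨ dominated (reflect l r) ⟩
          k                                            ∎))
          where open ℕₚ.≤-Reasoning
        swap-surjective : ∀ y → ∃ λ x → swap x ≡ y
        swap-surjective ((r , o) , w , s) with shortestSuffix (Past? r (toℕ o)) (λ ()) w
        ... | inj₁ none = ⊥-elim (none [] w refl (past r o w (Shape.rights≡ s) (Shape.ups≡ s)))
        -- An up step in front adds no right step and cannot shorten the boundary, so `p` would
        -- already be past it.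
        ... | inj₂ (q , up , p , refl , none , past) = ⊥-elim (none [] p refl
                (ℕₚ.≤-<-trans (ℕₚ.+-monoʳ-≤ (toℕ o) (sumBefore-suc r (ups p))) past))
        ... | inj₂ (q , right , p , refl , crosses) =
          ((start r o′ o<a p crosses , p , q) ,
            crossing (unswap-shape p q s) (crossesUp r o′ o<a p crosses)) ,
          marked-≡ (row-start r o′ o<a p crosses)
              (trans (toℕ-fromℕ< _) (offset-start r o′ o<a p crosses))
          where
          o′ = toℕ o
          o<a = toℕ<n o

    bad↔Fin : ∀ {n} → IsComposition m n a → ∀ k l → (∀ j → sumTo (shift m a j) l ≤ k) → ∀ c →
      LPBP Bad k l c ↔ Fin (n ℕ.* badShapes k l c)
    bad↔Fin {n} comp k zero dom c rewrite ℕₚ.*-zeroʳ n =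
      ↔-trans (↔-sym (crossings↔bad k zero c)) (empty↔Fin0
        λ { ((j , p , q) , crossing (shape _ u _) _) → no-up p q u })
      where
      no-up : ∀ p q → ¬ ups (p ++ up ∷ q) ≡ 0
      no-up p q eq with () ← trans (ups-swap p q) eq
    bad↔Fin refl k (suc l) dom c = ↔-trans (↔-sym (crossings↔bad k (suc l) c))
      (↔-trans (crossings↔marked dom c)
        (↔-trans (ΣFin↔Fin-sumFin a ×-↔ Paths↔Fin-count ruCorners-up (suc k) l c) (↔-sym *↔×)))

    good↔dominated : ∀ k l c → l ≤ m → GoodWithCorners m a (k , l) (+ c) ↔ LPBP (NoPrefix ∘ Under) k l c
    good↔dominated k l c l≤m = mk↔ₛ′
      (λ (j , w , e , d , c≡) → (j , w) ,
        shape (cong proj₁ (trans (sym (endpoint≡ w)) e)) (cong proj₂ (trans (sym (endpoint≡ w)) e))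
              (trans (sym (corners≡ruCorners-right w)) (ℤₚ.+-injective c≡)) ,
        λ u v eq → ℕₚ.≤⇒≯ (proj₂ (dominated⇒prefixes w d u v eq)))
      (λ ((j , w) , shape r u e , none) → j , w ,
        trans (endpoint≡ w) (cong₂ _,_ r u) ,
        prefixes⇒dominated w (λ p q eq →
          -- The height condition of `DominatedPt` is automatic: prefixes rise at most to l, and l ≤
          -- m.
          ℕₚ.≤-trans
            (subst (ups p ≤_) (trans (sym (ups-++ p q)) (trans (cong ups (sym eq)) u)) (ℕₚ.m≤m+n _ _))
            l≤m ,
          ℕₚ.≮⇒≥ (none p q eq)) ,
        cong +_ (trans (corners≡ruCorners-right w) e))
      (λ _ → Σ-≡ (×-irrelevant Shape-irrelevant (λ _ _ → refl)) refl)
      (λ (j , w , _) → cong (λ x → j , w , x)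
        (×-irrelevant uip (×-irrelevant
          (All.irrelevant (×-irrelevant ℕₚ.≤-irrelevant ℕₚ.≤-irrelevant)) uip) _ _))

-- Integer binomials and the final count

allShapes-binomℤ : ∀ k l c → + count (ruCorners ∘ (right ∷_)) k l c ≡
  binomℤ (+ suc k) (+ c) * binomℤ (+ l - + 1) (+ c - + 1)
-- The only path is the one made of right steps; the convention C(-1,-1) = 1 accounts for it.
allShapes-binomℤ k zero    zero    = cong +_ (count-right-flat-0 k)
allShapes-binomℤ k zero    (suc c) =
  trans (cong +_ (count-right-flat-suc k c)) (sym (ℤₚ.*-zeroʳ (+ (suc k C suc c))))
allShapes-binomℤ k (suc l) zero    = cong +_ (count-right-0 k l)
allShapes-binomℤ k (suc l) (suc c) = trans (cong +_ (count-right k l c)) (ℤₚ.pos-* (suc k C suc c) (l C c))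

badShapes-binomℤ : ∀ k l c → + badShapes k l c ≡ binomℤ (+ k) (+ c - + 1) * binomℤ (+ l) (+ c)
badShapes-binomℤ k zero    zero    = refl
badShapes-binomℤ k zero    (suc c) = sym (ℤₚ.*-zeroʳ (+ (k C c)))
badShapes-binomℤ k (suc l) zero    = cong +_ (count-up-0 k l)
badShapes-binomℤ k (suc l) (suc c) = trans (cong +_ (count-up k l c)) (ℤₚ.pos-* (k C c) (suc l C suc c))

+≡⇒≡- : ∀ {p x y} → p + x ≡ y → + p ≡ + y - + x
+≡⇒≡- {p} {x} refl = sym (begin
  + (p + x) - + x  ≡⟨ ℤₚ.m-n≡m⊖n (p + x) x ⟩
  (p + x) ⊖ x      ≡⟨ ℤₚ.⊖-≥ (ℕₚ.m≤n+m x p) ⟩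
  + (p + x ∸ x)    ≡⟨ cong +_ (ℕₚ.m+n∸n≡m p x) ⟩
  + p              ∎)
  where open ≡-Reasoning

*-zero-middle : ∀ x y → x * + 0 * y ≡ + 0
*-zero-middle x y = cong (_* y) (ℤₚ.*-zeroʳ x)

theorem3 : (m : ℕ) .{{_ : NonZero m}} (n : ℕ) (a : Fin m → ℕ) → IsComposition m n a →
    (k l : ℕ) → l ≤ m → (∀ j → DominatedPt m (shift m a j) (k , l)) →
    (c : ℤ) →
    Σ ℕ λ N → (GoodWithCorners m a (k , l) c ↔ Fin N) ×
    (+ N ≡ + m * binomℤ (+ suc k) c * binomℤ (+ l - + 1) (c - + 1)
    - + n * binomℤ (+ k) (c - + 1) * binomℤ (+ l) c)
-- No path has a negative number of corners, and the middle factor of each product vanishes because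
-- its lower index is negative.
theorem3 m n a comp k l l≤m dom -[1+ c ] = 0 , empty↔Fin0 (λ { (_ , _ , _ , _ , ()) })
  , sym (cong₂ _-_ (*-zero-middle (+ m) (binomℤ (+ l - + 1) (-[1+ c ] - + 1)))
                   (*-zero-middle (+ n) (binomℤ (+ l) -[1+ c ])))
theorem3 m n a comp k l l≤m dom (+ c)
  -- Good and bad pairs together are m copies of all the paths; removing the bad ones leaves the
  -- difference claimed.
  with p , good↔Fin , p+bad≡all ← ⊎-complement
         (↔-trans (good⊎bad↔all m a k l c)
           (↔-trans (↔-refl ×-↔ Paths↔Fin-count _ k l c) (↔-sym *↔×)))
         (bad↔Fin m a comp k l (proj₂ ∘ dom) c)
  = p , ↔-trans (good↔dominated m a k l c l≤m) good↔Fin , (begin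
    + p                                         ≡⟨ +≡⇒≡- p+bad≡all ⟩
    + (m ℕ.* all) - + (n ℕ.* badShapes k l c)   ≡⟨ cong₂ _-_ (ℤₚ.pos-* m all) (ℤₚ.pos-* n (badShapes k l c)) ⟩
    + m * + all - + n * + badShapes k l c
      ≡⟨ cong₂ (λ x y → + m * x - + n * y) (allShapes-binomℤ k l c) (badShapes-binomℤ k l c) ⟩
    + m * (binomℤ (+ suc k) (+ c) * binomℤ (+ l - + 1) (+ c - + 1)) -
    + n * (binomℤ (+ k) (+ c - + 1) * binomℤ (+ l) (+ c))
      ≡⟨ cong₂ _-_ (ℤₚ.*-assoc (+ m) (binomℤ (+ suc k) (+ c)) _) (ℤₚ.*-assoc (+ n) (binomℤ (+ k) (+ c - + 1)) _) ⟨
    + m * binomℤ (+ suc k) (+ c) * binomℤ (+ l - + 1) (+ c - + 1) -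
    + n * binomℤ (+ k) (+ c - + 1) * binomℤ (+ l) (+ c) ∎)
  where
  open ≡-Reasoning
  all = count (ruCorners ∘ (right ∷_)) k l c
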